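{- We have $$f_{0111}(x)=\frac{(1-x)^2-\sqrt{1-4x+2x^2+x^4}}{2x^2}$$ as formal power series in $x$, where $f_{0111}(x)=\sum_{n\ge 0} b_n(0111)x^n$ and $b_n(0111)$ is the number of ascent sequences of length $n$ that avoid both patterns $021$ and $0111$.
   Context: For a finite sequence $w=w_1\cdots w_n$ of integers, $\mathrm{asc}(w)$ is the number of indices $1\le i\le n-1$ with $w_i<w_{i+1}$. An ascent sequence of length $n\ge 1$ is a sequence $a_1\cdots a_n$ of non-negative integers such that $a_1=0$ and $a_i\le \mathrm{asc}(a_1\cdots a_{i-1})+1$ for $1<i\le n$; there is exactly one (empty) ascent sequence of length $0$. A sequence $\pi=\pi_1\cdots\pi_n$ contains a pattern $\tau=\tau_1\cdots\tau_m$ if there are indices $1\le i_1<\cdots<i_m\le n$ such that for all $j,k\in\{1,\dots,m\}$: $\pi_{i_j}<\pi_{i_k}$ iff $\tau_j<\tau_k$, and $\pi_{i_j}=\pi_{i_k}$ iff $\tau_j=\tau_k$; otherwise $\pi$ avoids $\tau$. For a pattern $\tau$, $B_n(\tau)$ is the set of ascent sequences of length $n$ avoiding both $021$ and $\tau$ (with $B_0(\tau)$ consisting of the empty sequence), and $b_n(\tau)=|B_n(\tau)|$. The square root denotes the formal power series square root with constant term $1$. -}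

module Defs where

open import Data.Bool.Base using (if_then_else_)
open import Data.Fin.Base as Fin using (Fin; zero; suc; toℕ; inject₁; fromℕ)
import Data.Fin.Properties as Finₚ
open import Data.Integer.Base using (+_)
open import Data.List.Base using (List; []; _∷_; length; lookup; take; upTo; filter; cartesianProductWith)
open import Data.List.Membership.Propositional using (_∈_)
open import Data.List.Membership.Propositional.Properties
  using (∈-upTo⁺; ∈-filter⁺; ∈-filter⁻; ∈-cartesianProductWith⁺; ∈-cartesianProductWith⁻)
open import Data.List.Properties using (length-take; ∷-injective)
open import Data.List.Relation.Unary.Any using (here)
open import Data.List.Relation.Unary.AllPairs using ([]; _∷_)
open import Data.List.Relation.Unary.All using ([])
open import Data.List.Relation.Unary.Unique.Propositional using (Unique)
import Data.List.Relation.Unary.Unique.Propositional.Properties as Uniqueₚ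
open import Data.Nat.Base as ℕ using (ℕ; zero; suc; z≤n; s≤s; _∸_; _≤_; _<_; _<ᵇ_)
import Data.Nat.Properties as ℕₚ
open import Data.Product using (_×_; _,_; proj₁; proj₂; ∃; ∃-syntax)
open import Data.Rational.Base as ℚ using (ℚ; 0ℚ; 1ℚ; ½; _/_)
import Data.Rational.Properties as ℚₚ
open import Data.Rational.Solver using (module +-*-Solver)
open import Data.Vec.Base as Vec using (Vec; []; _∷_)
open import Function.Base using (_∘_)
open import Function.Bundles using (_⇔_; mk⇔; Equivalence)
open import Level using (0ℓ)
open import Algebra.Bundles using (CommutativeRing)
open import Algebra.Properties.Semiring.Sum (CommutativeRing.semiring ℚₚ.+-*-commutativeRing)
  using (sum; sum-cong-≗; sum-init-last)
open import Relation.Binary.PropositionalEquality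
open import Relation.Nullary using (¬_; Dec; yes; no)
open import Relation.Nullary.Decidable using (map′; _×-dec_; _→-dec_; ¬?)
open import Relation.Unary using (Pred; Decidable)

------------------------------------------------------------------------
-- Ascent sequences

asc : List ℕ → ℕ
asc []          = 0
asc (x ∷ [])    = 0
asc (x ∷ y ∷ w) = (if x <ᵇ y then 1 else 0) ℕ.+ asc (y ∷ w)

-- Positions are counted from 0, so `take (toℕ i) a` is the part of `a`
-- strictly before the entry `lookup a i`.
IsAscentSequence : List ℕ → Set
IsAscentSequence a = ∀ (i : Fin (length a)) →
  (toℕ i ≡ 0 → lookup a i ≡ 0) ×
  (0 < toℕ i → lookup a i ≤ asc (take (toℕ i) a) ℕ.+ 1)

------------------------------------------------------------------------
-- Patterns

IsOccurrence : (τ π : List ℕ) → Vec (Fin (length π)) (length τ) → Set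
IsOccurrence τ π ι =
  (∀ j k → j Fin.< k → Vec.lookup ι j Fin.< Vec.lookup ι k) ×
  (∀ j k →
    (lookup π (Vec.lookup ι j) < lookup π (Vec.lookup ι k) ⇔ lookup τ j < lookup τ k) ×
    (lookup π (Vec.lookup ι j) ≡ lookup π (Vec.lookup ι k) ⇔ lookup τ j ≡ lookup τ k))

Contains : (τ π : List ℕ) → Set
Contains τ π = ∃[ ι ] IsOccurrence τ π ι

Avoids : (τ π : List ℕ) → Set
Avoids τ π = ¬ Contains τ π

B : ℕ → List ℕ → Pred (List ℕ) 0ℓ
B n τ w = length w ≡ n × IsAscentSequence w × Avoids (0 ∷ 2 ∷ 1 ∷ []) w × Avoids τ w

------------------------------------------------------------------------
-- Decidability

infix 4 _⇔-dec_

_⇔-dec_ : {P Q : Set} → Dec P → Dec Q → Dec (P ⇔ Q)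
p? ⇔-dec q? = map′ (λ (f , g) → mk⇔ f g) (λ e → Equivalence.to e , Equivalence.from e)
                   ((p? →-dec q?) ×-dec (q? →-dec p?))

anyVec? : ∀ {n} m {P : Pred (Vec (Fin n) m) 0ℓ} → Decidable P → Dec (∃ P)
anyVec? zero    P? = map′ ([] ,_) (λ { ([] , p) → p }) (P? [])
anyVec? (suc m) P? = map′ (λ (i , ι , p) → i ∷ ι , p) (λ { (i ∷ ι , p) → i , ι , p })
                          (Finₚ.any? λ i → anyVec? m λ ι → P? (i ∷ ι))

isAscentSequence? : Decidable IsAscentSequence
isAscentSequence? a = Finₚ.all? λ i →
  ((toℕ i ℕₚ.≟ 0) →-dec (lookup a i ℕₚ.≟ 0)) ×-dec
  ((0 ℕₚ.<? toℕ i) →-dec (lookup a i ℕₚ.≤? asc (take (toℕ i) a) ℕ.+ 1))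

isOccurrence? : ∀ τ π → Decidable (IsOccurrence τ π)
isOccurrence? τ π ι =
  (Finₚ.all? λ j → Finₚ.all? λ k → (j Finₚ.<? k) →-dec (Vec.lookup ι j Finₚ.<? Vec.lookup ι k)) ×-dec
  (Finₚ.all? λ j → Finₚ.all? λ k →
    ((lookup π (Vec.lookup ι j) ℕₚ.<? lookup π (Vec.lookup ι k)) ⇔-dec (lookup τ j ℕₚ.<? lookup τ k)) ×-dec
    ((lookup π (Vec.lookup ι j) ℕₚ.≟ lookup π (Vec.lookup ι k)) ⇔-dec (lookup τ j ℕₚ.≟ lookup τ k)))

contains? : ∀ τ π → Dec (Contains τ π)
contains? τ π = anyVec? (length τ) (isOccurrence? τ π)

B? : ∀ n τ → Decidable (B n τ)
B? n τ w = (length w ℕₚ.≟ n) ×-dec (isAscentSequence? w ×-dec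
             (¬? (contains? (0 ∷ 2 ∷ 1 ∷ []) w) ×-dec ¬? (contains? τ w)))

------------------------------------------------------------------------
-- Counting

words : (k n : ℕ) → List (List ℕ)
words k zero    = [] ∷ []
words k (suc n) = cartesianProductWith _∷_ (upTo k) (words k n)

-- Every entry of an ascent sequence of length n is less than n, so it
-- suffices to search the words over {0, …, n-1}; see `∈-enumerateB⁺`.
enumerateB : (n : ℕ) (τ : List ℕ) → List (List ℕ)
enumerateB n τ = filter (B? n τ) (words n n)

b : ℕ → List ℕ → ℕ
b n τ = length (enumerateB n τ)

words-unique : ∀ k n → Unique (words k n)
words-unique k zero    = [] ∷ []
words-unique k (suc n) =
  Uniqueₚ.cartesianProductWith⁺ _∷_ ∷-injective (Uniqueₚ.upTo⁺ k) (words-unique k n)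

∈-words : ∀ k w → (∀ i → lookup w i < k) → w ∈ words k (length w)
∈-words k []      lt = here refl
∈-words k (x ∷ w) lt =
  ∈-cartesianProductWith⁺ _∷_ (∈-upTo⁺ (lt zero)) (∈-words k w (lt ∘ suc))

asc≤ : ∀ w → asc w ≤ length w ∸ 1
asc≤ []          = z≤n
asc≤ (x ∷ [])    = z≤n
asc≤ (x ∷ y ∷ w) = ℕₚ.+-mono-≤ (bit≤1 (x <ᵇ y)) (asc≤ (y ∷ w))
  where
  bit≤1 : ∀ c → (if c then 1 else 0) ≤ 1
  bit≤1 Data.Bool.Base.false = z≤n
  bit≤1 Data.Bool.Base.true  = s≤s z≤n

entry≤position : ∀ {a} → IsAscentSequence a → ∀ i → lookup a i ≤ toℕ i
entry≤position {a} A i with toℕ i in eq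
... | zero  = ℕₚ.≤-reflexive (proj₁ (A i) eq)
... | suc m = begin
  lookup a i                              ≤⟨ proj₂ (A i) (subst (0 <_) (sym eq) (s≤s z≤n)) ⟩
  asc (take (toℕ i) a) ℕ.+ 1              ≡⟨ cong (λ p → asc (take p a) ℕ.+ 1) eq ⟩
  asc (take (suc m) a) ℕ.+ 1              ≤⟨ ℕₚ.+-monoˡ-≤ 1 (asc≤ (take (suc m) a)) ⟩
  (length (take (suc m) a) ∸ 1) ℕ.+ 1     ≤⟨ ℕₚ.+-monoˡ-≤ 1 (ℕₚ.∸-monoˡ-≤ 1 len≤) ⟩
  m ℕ.+ 1                                 ≡⟨ ℕₚ.+-comm m 1 ⟩
  suc m                                   ∎
  where
  open ℕₚ.≤-Reasoning
  len≤ : length (take (suc m) a) ≤ suc m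
  len≤ = subst (_≤ suc m) (sym (length-take (suc m) a)) (ℕₚ.m⊓n≤m (suc m) (length a))

enumerateB-unique : ∀ n τ → Unique (enumerateB n τ)
enumerateB-unique n τ = Uniqueₚ.filter⁺ (B? n τ) (words-unique n n)

∈-enumerateB⁻ : ∀ {n τ w} → w ∈ enumerateB n τ → B n τ w
∈-enumerateB⁻ {n} {τ} w∈ = proj₂ (∈-filter⁻ (B? n τ) {xs = words n n} w∈)

∈-enumerateB⁺ : ∀ {n τ w} → B n τ w → w ∈ enumerateB n τ
∈-enumerateB⁺ {τ = τ} {w = w} (refl , A , av) =
  ∈-filter⁺ (B? (length w) τ)
    (∈-words (length w) w λ i → ℕₚ.≤-<-trans (entry≤position A i) (Finₚ.toℕ<n i))
    (refl , A , av)

------------------------------------------------------------------------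
-- Formal power series over ℚ

PowerSeries : Set
PowerSeries = ℕ → ℚ

infix  4 _≈_
infixl 6 _+_ _-_
infixl 7 _*_
infixr 8 _^_

_≈_ : PowerSeries → PowerSeries → Set
_≈_ = _≗_

const : ℕ → PowerSeries
const c zero    = + c / 1
const c (suc _) = 0ℚ

x : PowerSeries
x 1 = 1ℚ
x _ = 0ℚ

_+_ _-_ _*_ : PowerSeries → PowerSeries → PowerSeries
(s + t) n = s n ℚ.+ t n
(s - t) n = s n ℚ.- t n
(s * t) n = sum {suc n} λ i → s (toℕ i) ℚ.* t (n ∸ toℕ i)

_^_ : PowerSeries → ℕ → PowerSeries
s ^ zero  = const 1
s ^ suc k = s * s ^ k

f : List ℕ → PowerSeries
f τ n = + b n τ / 1

------------------------------------------------------------------------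
-- Square roots

-- When a has constant term 1, each iteration of s ↦ s + (a − s²)/2
-- starting from s = 1 makes one more coefficient of s² agree with a, and
-- the n-th coefficient no longer changes after n iterations.  The limit
-- is the unique square root of a with constant term 1: see `sqrt₀`,
-- `sqrt-square` and `sqrt-unique`.

step : PowerSeries → PowerSeries → PowerSeries
step a s n = s n ℚ.+ ½ ℚ.* (a n ℚ.- (s * s) n)

approx : PowerSeries → ℕ → PowerSeries
approx a zero    = const 1
approx a (suc k) = step a (approx a k)

sqrt : PowerSeries → PowerSeries
sqrt a n = approx a n n

square-suc : ∀ s k → s 0 ≡ 1ℚ →
  (s * s) (suc k) ≡
    (s (suc k) ℚ.+ s (suc k)) ℚ.+ sum {k} (λ i → s (suc (toℕ i)) ℚ.* s (k ∸ toℕ i))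
square-suc s k s₀ = begin
  s 0 ℚ.* s (suc k) ℚ.+ sum t
    ≡⟨ cong₂ ℚ._+_ (trans (cong (ℚ._* s (suc k)) s₀) (ℚₚ.*-identityˡ (s (suc k)))) (sum-init-last t) ⟩
  s (suc k) ℚ.+ (sum (t ∘ inject₁) ℚ.+ t (fromℕ k))
    ≡⟨ cong (s (suc k) ℚ.+_) (cong₂ ℚ._+_ (sum-cong-≗ middle) final) ⟩
  s (suc k) ℚ.+ (sum m ℚ.+ s (suc k))
    ≡⟨ solve 2 (λ p q → p :+ (q :+ p) := (p :+ p) :+ q) refl (s (suc k)) (sum m) ⟩
  (s (suc k) ℚ.+ s (suc k)) ℚ.+ sum m ∎
  where
  open ≡-Reasoning
  open +-*-Solver
  t : Fin (suc k) → ℚ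
  t i = s (suc (toℕ i)) ℚ.* s (k ∸ toℕ i)
  m : Fin k → ℚ
  m i = s (suc (toℕ i)) ℚ.* s (k ∸ toℕ i)
  middle : ∀ i → t (inject₁ i) ≡ m i
  middle i = cong (λ p → s (suc p) ℚ.* s (k ∸ p)) (Finₚ.toℕ-inject₁ i)
  final : t (fromℕ k) ≡ s (suc k)
  final = begin
    t (fromℕ k)             ≡⟨ cong (λ p → s (suc p) ℚ.* s (k ∸ p)) (Finₚ.toℕ-fromℕ k) ⟩
    s (suc k) ℚ.* s (k ∸ k) ≡⟨ cong (λ p → s (suc k) ℚ.* s p) (ℕₚ.n∸n≡0 k) ⟩
    s (suc k) ℚ.* s 0       ≡⟨ cong (s (suc k) ℚ.*_) s₀ ⟩
    s (suc k) ℚ.* 1ℚ        ≡⟨ ℚₚ.*-identityʳ (s (suc k)) ⟩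
    s (suc k)               ∎

step-zero : ∀ a s → a 0 ≡ 1ℚ → s 0 ≡ 1ℚ → step a s 0 ≡ 1ℚ
step-zero a s a₀ s₀ =
  cong₂ (λ p c → p ℚ.+ ½ ℚ.* (c ℚ.- (p ℚ.* p ℚ.+ 0ℚ))) s₀ a₀

step-suc : ∀ a s k → s 0 ≡ 1ℚ →
  step a s (suc k) ≡
    ½ ℚ.* (a (suc k) ℚ.- sum {k} (λ i → s (suc (toℕ i)) ℚ.* s (k ∸ toℕ i)))
step-suc a s k s₀ = trans
  (cong (λ q → s (suc k) ℚ.+ ½ ℚ.* (a (suc k) ℚ.- q)) (square-suc s k s₀))
  (solve 3 (λ p c q → p :+ con ½ :* (c :- ((p :+ p) :+ q)) := con ½ :* (c :- q)) refl
    (s (suc k)) (a (suc k)) (sum {k} (λ i → s (suc (toℕ i)) ℚ.* s (k ∸ toℕ i))))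
  where open +-*-Solver

step-contracts : ∀ a s t n → s 0 ≡ 1ℚ → t 0 ≡ 1ℚ → (∀ i → i < n → s i ≡ t i) →
                 step a s n ≡ step a t n
step-contracts a s t zero    s₀ t₀ _ =
  cong (λ p → p ℚ.+ ½ ℚ.* (a 0 ℚ.- (p ℚ.* p ℚ.+ 0ℚ))) (trans s₀ (sym t₀))
step-contracts a s t (suc k) s₀ t₀ eq = begin
  step a s (suc k)
    ≡⟨ step-suc a s k s₀ ⟩
  ½ ℚ.* (a (suc k) ℚ.- sum {k} (λ i → s (suc (toℕ i)) ℚ.* s (k ∸ toℕ i)))
    ≡⟨ cong (λ q → ½ ℚ.* (a (suc k) ℚ.- q)) (sum-cong-≗ {k} λ i →
         cong₂ ℚ._*_ (eq _ (s≤s (Finₚ.toℕ<n i))) (eq _ (s≤s (ℕₚ.m∸n≤m k (toℕ i))))) ⟩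
  ½ ℚ.* (a (suc k) ℚ.- sum {k} (λ i → t (suc (toℕ i)) ℚ.* t (k ∸ toℕ i)))
    ≡⟨ step-suc a t k t₀ ⟨
  step a t (suc k) ∎
  where open ≡-Reasoning

module _ (a : PowerSeries) (a₀ : a 0 ≡ 1ℚ) where

  approx₀ : ∀ k → approx a k 0 ≡ 1ℚ
  approx₀ zero    = refl
  approx₀ (suc k) = step-zero a (approx a k) a₀ (approx₀ k)

  approx-stable : ∀ m n → n ≤ m → approx a (suc m) n ≡ approx a m n
  approx-stable zero    zero z≤n = approx₀ 1
  approx-stable (suc m) n    n≤  =
    step-contracts a (approx a (suc m)) (approx a m) n (approx₀ (suc m)) (approx₀ m)
      λ i i<n → approx-stable m i (ℕ.s≤s⁻¹ (ℕₚ.<-≤-trans i<n n≤))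

  approx≡sqrt : ∀ {m n} → n ℕ.≤′ m → approx a m n ≡ sqrt a n
  approx≡sqrt (ℕ.≤′-reflexive refl) = refl
  approx≡sqrt (ℕ.≤′-step n≤m) = trans (approx-stable _ _ (ℕₚ.≤′⇒≤ n≤m)) (approx≡sqrt n≤m)

  sqrt₀ : sqrt a 0 ≡ 1ℚ
  sqrt₀ = refl

  sqrt-fixed : step a (sqrt a) ≈ sqrt a
  sqrt-fixed n = begin
    step a (sqrt a) n     ≡⟨ step-contracts a (sqrt a) (approx a n) n sqrt₀ (approx₀ n)
                               (λ i i<n → sym (approx≡sqrt (ℕₚ.≤⇒≤′ (ℕₚ.<⇒≤ i<n)))) ⟩
    approx a (suc n) n    ≡⟨ approx-stable n n ℕₚ.≤-refl ⟩
    sqrt a n              ∎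
    where open ≡-Reasoning

  sqrt-square : sqrt a * sqrt a ≈ a
  sqrt-square n = begin
    q                                            ≡⟨ solve 3 (λ p c q → q := c :- (con two :* ((p :+ con ½ :* (c :- q)) :- p)))
                                                      refl p (a n) q ⟩
    a n ℚ.- two ℚ.* (step a (sqrt a) n ℚ.- p)    ≡⟨ cong (λ r → a n ℚ.- two ℚ.* (r ℚ.- p)) (sqrt-fixed n) ⟩
    a n ℚ.- two ℚ.* (p ℚ.- p)                    ≡⟨ solve 2 (λ p c → c :- con two :* (p :- p) := c) refl p (a n) ⟩
    a n                                          ∎
    where
    open ≡-Reasoning
    open +-*-Solver
    two p q : ℚ
    two = + 2 / 1
    p   = sqrt a n
    q   = (sqrt a * sqrt a) n

  sqrt-unique : ∀ s → s 0 ≡ 1ℚ → s * s ≈ a → s ≈ sqrt a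
  sqrt-unique s s₀ s² n = agree (suc n) n ℕₚ.≤-refl
    where
    open ≡-Reasoning
    open +-*-Solver
    fixed : step a s ≈ s
    fixed k = begin
      s k ℚ.+ ½ ℚ.* (a k ℚ.- (s * s) k) ≡⟨ cong (λ q → s k ℚ.+ ½ ℚ.* (a k ℚ.- q)) (s² k) ⟩
      s k ℚ.+ ½ ℚ.* (a k ℚ.- a k)       ≡⟨ solve 2 (λ p c → p :+ con ½ :* (c :- c) := p) refl (s k) (a k) ⟩
      s k                               ∎
    agree : ∀ m i → i < m → s i ≡ sqrt a i
    agree (suc m) i i<1+m = begin
      s i                ≡⟨ fixed i ⟨
      step a s i         ≡⟨ step-contracts a s (sqrt a) i s₀ sqrt₀
                              (λ j j<i → agree m j (ℕₚ.<-≤-trans j<i (ℕ.s≤s⁻¹ i<1+m))) ⟩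
      step a (sqrt a) i  ≡⟨ sqrt-fixed i ⟩
      sqrt a i           ∎

{-# OPTIONS --safe #-}

-- A sequence starting with 0 avoids 021 and 0111 iff its nonzero entries are
-- weakly increasing and none of them occurs three times.  Such ascent
-- sequences are read from left to right by an automaton whose state need only
-- remember whether the maximum m may be repeated, whether the last entry is 0,
-- and d = asc + 1 − m.  The generating function A_d of the continuations from a
-- state that does not allow a repetition satisfies
--   (1 − x)(1 − 2x − x²) A_{d+1} = (1 − x)² A_d + x³ A_{d+2},   (1 − x) A₀ = 1.
-- The minors A_{d+1} A₀ − A_d A₁ satisfy the same recurrence and start with 0,
-- hence vanish, since the recurrence determines its power series solutions by
-- their initial term.  So A₂ A₀ = A₁², which turns the recurrence at d = 0 into
-- a quadratic equation for F = 1 + x A₁, namely x²F² + 1 − x = (1 − x)² F.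
module Submission where

open import Algebra.Bundles using (CommutativeRing)
import Algebra.Solver.Ring
open import Algebra.Solver.Ring.AlmostCommutativeRing
  using (AlmostCommutativeRing; fromCommutativeRing; _-Raw-AlmostCommutative⟶_)
open import Data.Bool.Base using (if_then_else_)
open import Data.Fin using (#_)
open import Data.Fin.Base as Fin using (Fin; zero; suc; toℕ)
open import Data.Integer.Base as ℤ using (+_)
import Data.Integer.Properties as ℤₚ
open import Data.List.Base using (List; []; _∷_; _++_; length; lookup; map; concatMap; drop; take)
open import Data.List.Membership.Propositional using (_∈_; lose; find)
open import Data.List.Membership.Propositional.Properties
  using (∈-map⁺; ∈-map⁻; ∈-++⁺ʳ; ∈-concatMap⁺; ∈-concatMap⁻)
open import Data.List.Membership.Propositional.Properties.WithK using (unique∧set⇒bag)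
open import Data.List.Properties using (length-++; length-map; ∷-injectiveˡ; ∷-injectiveʳ)
open import Data.List.Relation.Binary.BagAndSetEquality using (∼bag⇒↭)
open import Data.List.Relation.Binary.Permutation.Propositional.Properties using (↭-length)
open import Data.List.Relation.Binary.Sublist.Propositional
  using (_⊆_; []; _∷_; _∷ʳ_; minimum; ⊆-trans; ⊆-refl)
open import Data.List.Relation.Unary.All as All using (All; []; _∷_)
import Data.List.Relation.Unary.All.Properties as Allₚ
open import Data.List.Relation.Unary.AllPairs as AllPairs using (AllPairs; []; _∷_)
import Data.List.Relation.Unary.AllPairs.Properties as AllPairsₚ
open import Data.List.Relation.Unary.Any using (here; there)
open import Data.List.Relation.Unary.Unique.Propositional using (Unique)
import Data.List.Relation.Unary.Unique.Propositional.Properties as Uniqueₚ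
open import Data.Maybe.Base using (Maybe; just; nothing)
open import Data.Nat.Base as ℕ using (ℕ; zero; suc; z≤n; s≤s; s≤s⁻¹; _≤_; _<_; _<ᵇ_; _∸_)
import Data.Nat.Properties as ℕₚ
open import Data.Product using (_×_; _,_; proj₁; proj₂; ∃-syntax)
open import Data.Rational.Base as ℚ using (ℚ; 0ℚ; 1ℚ; _/_)
import Data.Rational.Properties as ℚₚ
open import Data.Rational.Solver using (module +-*-Solver)
import Data.Rational.Unnormalised.Base as ℚᵘ
import Data.Rational.Unnormalised.Properties as ℚᵘₚ
open import Data.Sum.Base using (inj₁; inj₂)
open import Data.Vec.Base as Vec using ([]; _∷_)
open import Data.Vec.Properties using (lookup-map)
open import Defs using (_≈_; _+_; _-_; _*_; _^_; const; x; sqrt; f)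
open import Defs using
  ( asc; IsAscentSequence; Contains; Avoids; B; b
  ; enumerateB; enumerateB-unique; ∈-enumerateB⁺; ∈-enumerateB⁻
  ; PowerSeries; sqrt-unique )
open import Function.Base using (_∘_)
open import Function.Bundles using (_⇔_; mk⇔; Equivalence)
open import Level using (0ℓ)
open import Relation.Binary.Definitions using (tri<; tri≈; tri>)
open import Relation.Binary.PropositionalEquality
open import Relation.Nullary using (¬_; yes; no; contradiction)

-- Pattern containment and sublists

module _ {g : ℕ → ℕ} (g-mono : ∀ {m n} → m < n → g m < g n) where

  cancel-< : ∀ {m n} → g m < g n → m < n
  cancel-< {m} {n} gm<gn with ℕₚ.<-cmp m n
  ... | tri< m<n _ _ = m<n
  ... | tri≈ _ refl _ = contradiction gm<gn (ℕₚ.<-irrefl refl)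
  ... | tri> _ _ n<m = contradiction gm<gn (ℕₚ.<-asym (g-mono n<m))

  injective : ∀ {m n} → g m ≡ g n → m ≡ n
  injective {m} {n} eq with ℕₚ.<-cmp m n
  ... | tri< m<n _ _ = contradiction eq (ℕₚ.<⇒≢ (g-mono m<n))
  ... | tri≈ _ m≡n _ = m≡n
  ... | tri> _ _ n<m = contradiction (sym eq) (ℕₚ.<⇒≢ (g-mono n<m))

  positions : ∀ τ {π} → map g τ ⊆ π → ∃[ ι ]
    (∀ j k → j Fin.< k → Vec.lookup {n = length τ} ι j Fin.< Vec.lookup ι k) ×
    (∀ j → lookup π (Vec.lookup ι j) ≡ g (lookup τ j))
  positions []      p          = [] , (λ ()) , λ ()
  positions (t ∷ τ) {π = y ∷ π} (y ∷ʳ p) with ι , inc , val ← positions (t ∷ τ) p =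
    Vec.map suc ι ,
    (λ j k j<k → subst₂ Fin._<_ (sym (lookup-map j suc ι)) (sym (lookup-map k suc ι)) (s≤s (inc j k j<k))) ,
    (λ j → trans (cong (lookup (y ∷ π)) (lookup-map j suc ι)) (val j))
  positions (t ∷ τ) {π = _ ∷ π} (refl ∷ p) with ι , inc , val ← positions τ p =
    zero ∷ Vec.map suc ι ,
    (λ { zero    (suc k) _         → subst (λ i → 0 < toℕ i) (sym (lookup-map k suc ι)) (s≤s z≤n)
       ; (suc j) (suc k) (s≤s j<k) →
           subst₂ Fin._<_ (sym (lookup-map j suc ι)) (sym (lookup-map k suc ι)) (s≤s (inc j k j<k)) }) ,
    (λ { zero → refl ; (suc j) → trans (cong (lookup (g t ∷ π)) (lookup-map j suc ι)) (val j) })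

  -- A strictly monotone `g` on all of ℕ reflects both order and equality, so `g-mono` alone
  -- supplies both equivalences of an occurrence.
  image-⊆⇒contains : ∀ τ {π} → map g τ ⊆ π → Contains τ π
  image-⊆⇒contains τ {π} p with ι , inc , val ← positions τ p = ι , inc , λ j k →
    mk⇔ (λ lt → cancel-< (subst₂ _<_ (val j) (val k) lt))
        (λ lt → subst₂ _<_ (sym (val j)) (sym (val k)) (g-mono lt)) ,
    mk⇔ (λ eq → injective (trans (sym (val j)) (trans eq (val k))))
        (λ eq → trans (val j) (trans (cong g eq) (sym (val k))))

-- The way back from occurrences to sublists, applied from the last position to the first. `n` is
-- the first position still available; taking it one past the preceding position makes successive
-- applications fit together.
lookup-∷-⊆ : ∀ (π : List ℕ) (i : Fin (length π)) {n xs} → n ≤ toℕ i →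
             xs ⊆ drop (suc (toℕ i)) π → lookup π i ∷ xs ⊆ drop n π
lookup-∷-⊆ (y ∷ π) zero    z≤n       p = refl ∷ p
lookup-∷-⊆ (y ∷ π) (suc i) z≤n       p = y ∷ʳ lookup-∷-⊆ π i z≤n p
lookup-∷-⊆ (y ∷ π) (suc i) (s≤s n≤i) p = lookup-∷-⊆ π i n≤i p

∷-⊆-∷⁻ : ∀ {y z : ℕ} {xs ys} → y ∷ xs ⊆ z ∷ ys → xs ⊆ ys
∷-⊆-∷⁻ (_ ∷ʳ p) = ⊆-trans (_ ∷ʳ ⊆-refl) p
∷-⊆-∷⁻ (_ ∷ p)  = p

-- Avoidance for words with leading 0

NoDescent NoTriple : List ℕ → Set
NoDescent w = ∀ {a b} → a ∷ b ∷ [] ⊆ w → 0 < b → a ≤ b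
NoTriple  w = ∀ {a} → a ∷ a ∷ a ∷ [] ⊆ w → ¬ 0 < a

-- The leading 0 can play the 0 of the pattern. Conversely, whatever plays it lies strictly below
-- the entry playing 1, which is therefore positive; dropping the first entry of the occurrence
-- leaves a descent inside `w`.
avoids-021⇔ : ∀ w → Avoids (0 ∷ 2 ∷ 1 ∷ []) (0 ∷ w) ⇔ NoDescent w
avoids-021⇔ w = mk⇔ to from
  where
  to : Avoids (0 ∷ 2 ∷ 1 ∷ []) (0 ∷ w) → NoDescent w
  to av {a} {b} p 0<b = ℕₚ.≮⇒≥ λ b<a → av (image-⊆⇒contains (g-mono b<a) (0 ∷ 2 ∷ 1 ∷ []) (refl ∷ p))
    where
    g : ℕ → ℕ
    g 0             = 0
    g 1             = b
    -- Only the values at 0, 1, 2 are prescribed; adding `n` keeps `g` strictly monotone beyond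
    -- them.
    g (suc (suc n)) = n ℕ.+ a
    g-mono : b < a → ∀ {m n} → m < n → g m < g n
    g-mono b<a {0}           {1}           _  = 0<b
    g-mono b<a {0}           {suc (suc n)} _  = ℕₚ.<-≤-trans (ℕₚ.<-trans 0<b b<a) (ℕₚ.m≤n+m a n)
    g-mono b<a {1}           {suc (suc n)} _  = ℕₚ.<-≤-trans b<a (ℕₚ.m≤n+m a n)
    g-mono b<a {1}           {1}           lt = contradiction lt (ℕₚ.<-irrefl refl)
    g-mono b<a {suc (suc m)} {suc (suc n)} lt = ℕₚ.+-monoˡ-< a (s≤s⁻¹ (s≤s⁻¹ lt))
    g-mono b<a {suc (suc m)} {1}           (s≤s ())
  from : NoDescent w → Avoids (0 ∷ 2 ∷ 1 ∷ []) (0 ∷ w)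
  from nd (i ∷ j ∷ k ∷ [] , inc , iso) =
    contradiction (nd (∷-⊆-∷⁻ p) (ℕₚ.≤-<-trans z≤n (Equivalence.from (proj₁ (iso (# 0) (# 2))) (s≤s z≤n))))
                  (ℕₚ.<⇒≱ (Equivalence.from (proj₁ (iso (# 2) (# 1))) (s≤s (s≤s z≤n))))
    where
    p : lookup (0 ∷ w) i ∷ lookup (0 ∷ w) j ∷ lookup (0 ∷ w) k ∷ [] ⊆ 0 ∷ w
    p = lookup-∷-⊆ (0 ∷ w) i z≤n (lookup-∷-⊆ (0 ∷ w) j (inc (# 0) (# 1) (s≤s z≤n))
          (lookup-∷-⊆ (0 ∷ w) k (inc (# 1) (# 2) (s≤s (s≤s z≤n))) (minimum _)))

avoids-0111⇔ : ∀ w → Avoids (0 ∷ 1 ∷ 1 ∷ 1 ∷ []) (0 ∷ w) ⇔ NoTriple w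
avoids-0111⇔ w = mk⇔ to from
  where
  to : Avoids (0 ∷ 1 ∷ 1 ∷ 1 ∷ []) (0 ∷ w) → NoTriple w
  to av {zero}  p ()
  to av {suc a} p _ = av (image-⊆⇒contains g-mono (0 ∷ 1 ∷ 1 ∷ 1 ∷ []) (refl ∷ p))
    where
    g : ℕ → ℕ
    g 0       = 0
    g (suc n) = suc n ℕ.+ a
    g-mono : ∀ {m n} → m < n → g m < g n
    g-mono {zero}  {suc n} _  = s≤s z≤n
    g-mono {suc m} {suc n} lt = ℕₚ.+-monoˡ-< a lt
  from : NoTriple w → Avoids (0 ∷ 1 ∷ 1 ∷ 1 ∷ []) (0 ∷ w)
  from nt (i ∷ j ∷ k ∷ l ∷ [] , inc , iso) =
    nt (subst₂ (λ y z → π₁ ∷ y ∷ z ∷ [] ⊆ w)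
         (Equivalence.from (proj₂ (iso (# 2) (# 1))) refl) (Equivalence.from (proj₂ (iso (# 3) (# 1))) refl) (∷-⊆-∷⁻ p))
       (ℕₚ.≤-<-trans z≤n (Equivalence.from (proj₁ (iso (# 0) (# 1))) (s≤s z≤n)))
    where
    π₁ : ℕ
    π₁ = lookup (0 ∷ w) j
    p : lookup (0 ∷ w) i ∷ π₁ ∷ lookup (0 ∷ w) k ∷ lookup (0 ∷ w) l ∷ [] ⊆ 0 ∷ w
    p = lookup-∷-⊆ (0 ∷ w) i z≤n (lookup-∷-⊆ (0 ∷ w) j (inc (# 0) (# 1) (s≤s z≤n))
          (lookup-∷-⊆ (0 ∷ w) k (inc (# 1) (# 2) (s≤s (s≤s z≤n)))
            (lookup-∷-⊆ (0 ∷ w) l (inc (# 2) (# 3) (s≤s (s≤s (s≤s z≤n)))) (minimum _))))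

-- The automaton

bit : ℕ → ℕ → ℕ
bit l v = if l <ᵇ v then 1 else 0

bit-< : ∀ {l v} → l < v → bit l v ≡ 1
bit-< {zero}  {suc v} _         = refl
bit-< {suc l} {suc v} (s≤s l<v) = bit-< l<v

bit-refl : ∀ v → bit v v ≡ 0
bit-refl zero    = refl
bit-refl (suc v) = bit-refl v

-- w continues a word that has last entry l and k ascents.
AscendsFrom : ℕ → ℕ → List ℕ → Set
AscendsFrom l k w = ∀ j → lookup w j ≤ (k ℕ.+ asc (take (suc (toℕ j)) (l ∷ w))) ℕ.+ 1

bound-head : ∀ k → k ℕ.+ 0 ℕ.+ 1 ≡ suc k
bound-head k = trans (cong (ℕ._+ 1) (ℕₚ.+-identityʳ k)) (ℕₚ.+-comm k 1)

bound-tail : ∀ k c m → (c ℕ.+ k) ℕ.+ m ≡ k ℕ.+ (c ℕ.+ m)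
bound-tail k c m = trans (cong (ℕ._+ m) (ℕₚ.+-comm c k)) (ℕₚ.+-assoc k c m)

ascendsFrom-∷⁺ : ∀ {l k v w} → v ≤ suc k → AscendsFrom v (bit l v ℕ.+ k) w → AscendsFrom l k (v ∷ w)
ascendsFrom-∷⁺ {k = k} {v} v≤ h zero = subst (v ≤_) (sym (bound-head k)) v≤
ascendsFrom-∷⁺ {l} {k} {v} {w} v≤ h (suc j) =
  subst (λ m → lookup w j ≤ m ℕ.+ 1) (bound-tail k (bit l v) (asc (v ∷ take (toℕ j) w))) (h j)

ascendsFrom-head : ∀ {l k v w} → AscendsFrom l k (v ∷ w) → v ≤ suc k
ascendsFrom-head {k = k} {v} h = subst (v ≤_) (bound-head k) (h zero)

ascendsFrom-tail : ∀ {l k v w} → AscendsFrom l k (v ∷ w) → AscendsFrom v (bit l v ℕ.+ k) w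
ascendsFrom-tail {l} {k} {v} {w} h j =
  subst (λ m → lookup w j ≤ m ℕ.+ 1) (sym (bound-tail k (bit l v) (asc (v ∷ take (toℕ j) w)))) (h (suc j))

isAscentSequence-0∷⇔ : ∀ w → IsAscentSequence (0 ∷ w) ⇔ AscendsFrom 0 0 w
isAscentSequence-0∷⇔ w = mk⇔ (λ A j → proj₂ (A (suc j)) (s≤s z≤n))
  λ { h zero    → (λ _ → refl) , λ ()
    ; h (suc j) → (λ ()) , λ _ → h j }

-- A state records the part of an ascent sequence read so far, through its
-- largest entry m (`top`) and the excess d = asc + 1 − m (`slack`).
--   done  q d : m = q, and m may not be used again
--   open₀ q d : m = 1 + q was used once, and the last entry is 0
--   open₁ q d : m = 1 + q was used once, and is the last entry
-- In each case the nonzero entries still allowed are those exceeding q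
-- (`floor`).
data State : Set where
  done open₀ open₁ : (q d : ℕ) → State

floor top slack : State → ℕ
floor (done  q d) = q
floor (open₀ q d) = q
floor (open₁ q d) = q
top (done  q d) = q
top (open₀ q d) = suc q
top (open₁ q d) = suc q
slack (done  q d) = d
slack (open₀ q d) = d
slack (open₁ q d) = d

-- Whether the last entry is 0 matters only while the maximum may be repeated: the repetition is an
-- ascent after 0 and none directly after the maximum. From `done`, every nonzero entry is an ascent
-- anyway.
rest : State → State
rest (open₁ q d) = open₀ q d
rest s           = s

infix 4 _—[_]→_

data _—[_]→_ : State → ℕ → State → Set where
  zero   : ∀ {s} → s —[ 0 ]→ rest s
  again₀ : ∀ {q d} → open₀ q d —[ suc q ]→ done (suc q) (suc d)
  again₁ : ∀ {q d} → open₁ q d —[ suc q ]→ done (suc q) d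
  -- Both sides equal asc + 1 before the move. The maximum becomes `suc q` and asc grows by one, so
  -- the new slack is asc + 1 - q; requiring it to be a successor says that the entry `suc q` is at
  -- most asc + 1.
  up     : ∀ {s q e} → top s ≤ q → q ℕ.+ suc e ≡ top s ℕ.+ slack s → s —[ suc q ]→ open₁ q (suc e)

data Accepts (s : State) : List ℕ → Set where
  []  : Accepts s []
  _∷_ : ∀ {v s′ w} → s —[ v ]→ s′ → Accepts s′ w → Accepts s (v ∷ w)

floor≤top : ∀ s → floor s ≤ top s
floor≤top (done q d)  = ℕₚ.≤-refl
floor≤top (open₀ q d) = ℕₚ.n≤1+n q
floor≤top (open₁ q d) = ℕₚ.n≤1+n q

floor-rest : ∀ s → floor (rest s) ≡ floor s
floor-rest (done q d)  = refl
floor-rest (open₀ q d) = refl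
floor-rest (open₁ q d) = refl

top-rest : ∀ s → top (rest s) ≡ top s
top-rest (done q d)  = refl
top-rest (open₀ q d) = refl
top-rest (open₁ q d) = refl

floor-mono : ∀ {s v s′} → s —[ v ]→ s′ → floor s ≤ floor s′
floor-mono {s} zero     = ℕₚ.≤-reflexive (sym (floor-rest s))
floor-mono again₀       = ℕₚ.n≤1+n _
floor-mono again₁       = ℕₚ.n≤1+n _
floor-mono {s} (up t≤q _) = ℕₚ.≤-trans (floor≤top s) t≤q

top-mono : ∀ {s v s′} → s —[ v ]→ s′ → top s ≤ top s′
top-mono {s} zero     = ℕₚ.≤-reflexive (sym (top-rest s))
top-mono again₀       = ℕₚ.≤-refl
top-mono again₁       = ℕₚ.≤-refl
top-mono (up t≤q _)   = ℕₚ.m≤n⇒m≤1+n t≤q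

label>floor : ∀ {s v s′} → s —[ v ]→ s′ → 0 < v → floor s < v
label>floor again₀ _         = ℕₚ.≤-refl
label>floor again₁ _         = ℕₚ.≤-refl
label>floor {s} (up t≤q _) _ = s≤s (ℕₚ.≤-trans (floor≤top s) t≤q)

label≤1+floor : ∀ {s v s′} → s —[ v ]→ s′ → v ≤ suc (floor s′)
label≤1+floor zero     = z≤n
label≤1+floor again₀   = ℕₚ.n≤1+n _
label≤1+floor again₁   = ℕₚ.n≤1+n _
label≤1+floor (up _ _) = ℕₚ.≤-refl

label≤top : ∀ {s v s′} → s —[ v ]→ s′ → v ≤ top s′
label≤top zero     = z≤n
label≤top again₀   = ℕₚ.≤-refl
label≤top again₁   = ℕₚ.≤-refl
label≤top (up _ _) = ℕₚ.≤-refl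

label-repeats : ∀ {s v s′} → s —[ v ]→ s′ → floor s′ < v → top s < v
label-repeats again₀ lt      = contradiction lt (ℕₚ.<-irrefl refl)
label-repeats again₁ lt      = contradiction lt (ℕₚ.<-irrefl refl)
label-repeats (up t≤q _) _   = s≤s t≤q

-- Accepted words satisfy the conditions

accepts⇒>floor : ∀ {s w v} → Accepts s w → v ∷ [] ⊆ w → 0 < v → floor s < v
accepts⇒>floor (m ∷ ms) (_ ∷ʳ p)   0<v = ℕₚ.≤-<-trans (floor-mono m) (accepts⇒>floor ms p 0<v)
accepts⇒>floor (m ∷ ms) (refl ∷ p) 0<v = label>floor m 0<v

-- Reading `v` raises the floor to at least `v` - 1, and later nonzero entries exceed the floor.
accepts⇒noDescent : ∀ {s w} → Accepts s w → NoDescent w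
accepts⇒noDescent (m ∷ ms) (_ ∷ʳ p)   0<b = accepts⇒noDescent ms p 0<b
accepts⇒noDescent (m ∷ ms) (refl ∷ p) 0<b = ℕₚ.≤-trans (label≤1+floor m) (accepts⇒>floor ms p 0<b)

-- If `v` can still be read after its first occurrence, the floor is then below `v`. Among the
-- nonzero moves only `up` leaves it there, and `up` requires `v` to exceed the old maximum.
accepts⇒double>top : ∀ {s w v} → Accepts s w → v ∷ v ∷ [] ⊆ w → 0 < v → top s < v
accepts⇒double>top (m ∷ ms) (_ ∷ʳ p)   0<v = ℕₚ.≤-<-trans (top-mono m) (accepts⇒double>top ms p 0<v)
accepts⇒double>top (m ∷ ms) (refl ∷ p) 0<v = label-repeats m (accepts⇒>floor ms p 0<v)

-- After the first copy the maximum is at least `v`, whereas the two remaining copies would force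
-- `v` above it.
accepts⇒noTriple : ∀ {s w} → Accepts s w → NoTriple w
accepts⇒noTriple (m ∷ ms) (_ ∷ʳ p)   0<v = accepts⇒noTriple ms p 0<v
accepts⇒noTriple (m ∷ ms) (refl ∷ p) 0<v = ℕₚ.<⇒≱ (accepts⇒double>top ms p 0<v) (label≤top m)

-- For `done` a bound suffices: its nonzero moves are all `up`, with labels exceeding `q`, hence
-- ascents for every such last entry.
LastEntry : State → ℕ → Set
LastEntry (done  q d) l = l ≤ q
LastEntry (open₀ q d) l = l ≡ 0
LastEntry (open₁ q d) l = l ≡ suc q

lastEntry≤top : ∀ s {l} → LastEntry s l → l ≤ top s
lastEntry≤top (done q d)  l≤q  = l≤q
lastEntry≤top (open₀ q d) refl = z≤n
lastEntry≤top (open₁ q d) refl = ℕₚ.≤-refl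

Invariant : State → ℕ → ℕ → Set
Invariant s l k = LastEntry s l × top s ℕ.+ slack s ≡ suc k

invariant-step : ∀ {s v s′ l k} → s —[ v ]→ s′ → Invariant s l k → Invariant s′ v (bit l v ℕ.+ k)
invariant-step {s = done q d}  zero (_ , eq) = z≤n , eq
invariant-step {s = open₀ q d} zero (_ , eq) = refl , eq
invariant-step {s = open₁ q d} zero (_ , eq) = refl , eq
invariant-step {s = open₀ q d} again₀ (refl , eq) = ℕₚ.≤-refl , trans (ℕₚ.+-suc (suc q) d) (cong suc eq)
invariant-step {s = open₁ q d} {k = k} again₁ (refl , eq) =
  ℕₚ.≤-refl , trans eq (cong (λ m → suc (m ℕ.+ k)) (sym (bit-refl q)))
invariant-step {s} {k = k} (up {q = q} t≤q eq′) (last , eq) =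
  refl , cong suc (trans eq′ (trans eq (cong (ℕ._+ k) (sym (bit-< (s≤s (ℕₚ.≤-trans (lastEntry≤top s last) t≤q)))))))

label≤1+asc : ∀ {s v s′ l k} → s —[ v ]→ s′ → Invariant s l k → v ≤ suc k
label≤1+asc zero _                       = z≤n
label≤1+asc again₀ (_ , eq)              = ℕₚ.≤-trans (ℕₚ.m≤m+n _ _) (ℕₚ.≤-reflexive eq)
label≤1+asc again₁ (_ , eq)              = ℕₚ.≤-trans (ℕₚ.m≤m+n _ _) (ℕₚ.≤-reflexive eq)
label≤1+asc (up {q = q} {e} _ eq′) (_ , eq) =
  ℕₚ.≤-trans (s≤s (ℕₚ.m≤m+n q e)) (ℕₚ.≤-reflexive (trans (sym (ℕₚ.+-suc q e)) (trans eq′ eq)))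

accepts⇒ascendsFrom : ∀ {s l k w} → Invariant s l k → Accepts s w → AscendsFrom l k w
accepts⇒ascendsFrom inv (m ∷ ms) =
  ascendsFrom-∷⁺ (label≤1+asc m inv) (accepts⇒ascendsFrom (invariant-step m inv) ms)

-- Words satisfying the conditions are accepted

-- What a state demands of the rest of the word on account of the part already read. Taken at the
-- floor and at the top, these are the conclusions of `accepts⇒>floor` and `accepts⇒double>top`, now
-- serving as hypotheses.
SinglesAbove DoublesAbove : ℕ → List ℕ → Set
SinglesAbove m w = ∀ {v} → v ∷ [] ⊆ w → 0 < v → m < v
DoublesAbove m w = ∀ {v} → v ∷ v ∷ [] ⊆ w → 0 < v → m < v

-- A nonzero entry above `top s` is read by `up`. Any other lies above the floor and not above the
-- top: impossible in `done`, where the two agree, and equal to the top in the open states, where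
-- they differ by one.
accepts : ∀ {s l k} w → Invariant s l k → AscendsFrom l k w → NoDescent w → NoTriple w →
          SinglesAbove (floor s) w → DoublesAbove (top s) w → Accepts s w
accepts-step : ∀ {s l k v s′} w → s —[ v ]→ s′ → Invariant s l k → AscendsFrom l k (v ∷ w) →
               NoDescent (v ∷ w) → NoTriple (v ∷ w) →
               SinglesAbove (floor s′) w → DoublesAbove (top s′) w → Accepts s (v ∷ w)
accepts-again : ∀ {s l k q d} w → s —[ suc q ]→ done (suc q) d → q ≡ floor s → suc q ≡ top s →
                Invariant s l k → AscendsFrom l k (suc q ∷ w) → NoDescent (suc q ∷ w) → NoTriple (suc q ∷ w) →
                SinglesAbove (floor s) (suc q ∷ w) → DoublesAbove (top s) (suc q ∷ w) → Accepts s (suc q ∷ w)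

accepts-step w m inv asc nd nt single double =
  m ∷ accepts w (invariant-step m inv) (ascendsFrom-tail asc) (nd ∘ (_ ∷ʳ_)) (nt ∘ (_ ∷ʳ_)) single double

accepts-again {q = q} w m refl eq inv asc nd nt single double =
  accepts-step w m inv asc nd nt above (above ∘ ⊆-trans (refl ∷ (_ ∷ʳ [])))
  where
  above : SinglesAbove (suc q) w
  above p 0<v = ℕₚ.≤∧≢⇒< (single (_ ∷ʳ p) 0<v)
    -- A further copy of `suc q` would form a double with the one just read, which `double` places
    -- above `top s`, that is, above itself.
    λ { refl → ℕₚ.<-irrefl (sym eq) (double (refl ∷ p) 0<v) }

accepts []          inv asc nd nt single double = []
accepts {s} (zero ∷ w)  inv asc nd nt single double =
  accepts-step w zero inv asc nd nt
    (subst (λ m → SinglesAbove m w) (sym (floor-rest s)) (single ∘ (_ ∷ʳ_)))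
    (subst (λ m → DoublesAbove m w) (sym (top-rest s)) (double ∘ (_ ∷ʳ_)))
accepts {s} {l} {k} (suc v ∷ w) inv asc nd nt single double with top s ℕₚ.≤? v
... | yes t≤v = accepts-step w (up t≤v eq) inv asc nd nt (nd ∘ (refl ∷_)) above
  where
  -- The new slack is `suc (k ∸ v)`; the bound on the head gives `v ≤ k`, so the truncated
  -- subtraction is exact.
  eq : v ℕ.+ suc (k ∸ v) ≡ top s ℕ.+ slack s
  eq = trans (ℕₚ.+-suc v (k ∸ v))
         (trans (cong suc (ℕₚ.m+[n∸m]≡n (s≤s⁻¹ (ascendsFrom-head asc)))) (sym (proj₂ inv)))
  -- Later nonzero entries are at least `suc v`, and a later double of `suc v` itself would complete
  -- a triple.
  above : DoublesAbove (suc v) w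
  above p 0<b = ℕₚ.≤∧≢⇒< (nd (refl ∷ ⊆-trans (refl ∷ (_ ∷ʳ [])) p) 0<b)
    λ { refl → nt (refl ∷ p) 0<b }
accepts {done q d} (suc v ∷ w) inv asc nd nt single double | no t≰v =
  contradiction (s≤s⁻¹ (single (refl ∷ minimum w) (s≤s z≤n))) t≰v
accepts {open₀ q d} (suc v ∷ w) inv asc nd nt single double | no t≰v
  with refl ← ℕₚ.≤-antisym (s≤s⁻¹ (ℕₚ.≰⇒> t≰v)) (s≤s⁻¹ (single (refl ∷ minimum w) (s≤s z≤n))) =
  accepts-again w again₀ refl refl inv asc nd nt single double
accepts {open₁ q d} (suc v ∷ w) inv asc nd nt single double | no t≰v
  with refl ← ℕₚ.≤-antisym (s≤s⁻¹ (ℕₚ.≰⇒> t≰v)) (s≤s⁻¹ (single (refl ∷ minimum w) (s≤s z≤n))) =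
  accepts-again w again₁ refl refl inv asc nd nt single double

-- The state after the leading 0: m = 0 and d = 0 + 1 - 0 = 1. It is a `done` state because repeated
-- zeros are read by the move `zero`.
start : State
start = done 0 1

B-0∷⇔accepts : ∀ n w → B (suc n) (0 ∷ 1 ∷ 1 ∷ 1 ∷ []) (0 ∷ w) ⇔ (length w ≡ n × Accepts start w)
B-0∷⇔accepts n w = mk⇔
  (λ (len , A , av₁ , av₂) → ℕₚ.suc-injective len ,
     accepts w (z≤n , refl) (to (isAscentSequence-0∷⇔ w) A) (to (avoids-021⇔ w) av₁) (to (avoids-0111⇔ w) av₂)
       (λ _ 0<v → 0<v) (λ _ 0<v → 0<v))
  (λ (len , acc) → cong suc len , from (isAscentSequence-0∷⇔ w) (accepts⇒ascendsFrom (z≤n , refl) acc) ,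
     from (avoids-021⇔ w) (accepts⇒noDescent acc) , from (avoids-0111⇔ w) (accepts⇒noTriple acc))
  where open Equivalence

-- Enumeration of the accepted words

again : State → List (ℕ × State)
again (done  q d) = []
again (open₀ q d) = (suc q , done (suc q) (suc d)) ∷ []
again (open₁ q d) = (suc q , done (suc q) d) ∷ []

-- The sum of the two arguments stays constant along the recursion, which is the equation demanded
-- by `up`.
ups : ℕ → ℕ → List (ℕ × State)
ups q zero    = []
ups q (suc d) = (suc q , open₁ q (suc d)) ∷ ups (suc q) d

moves : State → List (ℕ × State)
moves s = (0 , rest s) ∷ again s ++ ups (top s) (slack s)

∈-ups⁺ : ∀ {t q e} d → t ≤ q → q ℕ.+ suc e ≡ t ℕ.+ d → (suc q , open₁ q (suc e)) ∈ ups t d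
∈-ups⁺ {t} {q} {e} zero t≤q eq = contradiction
  (subst (q <_) (trans eq (ℕₚ.+-identityʳ t)) (ℕₚ.m<m+n q (s≤s z≤n))) (ℕₚ.≤⇒≯ t≤q)
∈-ups⁺ {t} {q} (suc d) t≤q eq with ℕₚ.m≤n⇒m<n∨m≡n t≤q
... | inj₁ t<q  = there (∈-ups⁺ d t<q (trans eq (ℕₚ.+-suc t d)))
... | inj₂ refl with refl ← ℕₚ.+-cancelˡ-≡ t _ _ eq = here refl

∈-ups⁻ : ∀ {t v s′} d → (v , s′) ∈ ups t d →
         ∃[ q ] ∃[ e ] v ≡ suc q × s′ ≡ open₁ q (suc e) × t ≤ q × q ℕ.+ suc e ≡ t ℕ.+ d
∈-ups⁻ {t} (suc d) (here refl) = t , d , refl , refl , ℕₚ.≤-refl , refl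
∈-ups⁻ {t} (suc d) (there m∈) with q , e , v≡ , s≡ , t<q , eq ← ∈-ups⁻ d m∈ =
  q , e , v≡ , s≡ , ℕₚ.<⇒≤ t<q , trans eq (sym (ℕₚ.+-suc t d))

∈-moves⁺ : ∀ {s v s′} → s —[ v ]→ s′ → (v , s′) ∈ moves s
∈-moves⁺ zero   = here refl
∈-moves⁺ again₀ = there (here refl)
∈-moves⁺ again₁ = there (here refl)
∈-moves⁺ {s} (up t≤q eq) = there (∈-++⁺ʳ (again s) (∈-ups⁺ (slack s) t≤q eq))

∈-ups⇒move : ∀ {s v s′} → (v , s′) ∈ ups (top s) (slack s) → s —[ v ]→ s′
∈-ups⇒move {s} m∈ with q , e , refl , refl , t≤q , eq ← ∈-ups⁻ (slack s) m∈ = up t≤q eq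

∈-moves⁻ : ∀ s {v s′} → (v , s′) ∈ moves s → s —[ v ]→ s′
∈-moves⁻ s           (here refl)         = zero
∈-moves⁻ (done q d)  (there m∈)          = ∈-ups⇒move m∈
∈-moves⁻ (open₀ q d) (there (here refl)) = again₀
∈-moves⁻ (open₀ q d) (there (there m∈))  = ∈-ups⇒move m∈
∈-moves⁻ (open₁ q d) (there (here refl)) = again₁
∈-moves⁻ (open₁ q d) (there (there m∈))  = ∈-ups⇒move m∈

completions : State → ℕ → List (List ℕ)
extend : ℕ → ℕ × State → List (List ℕ)
completions s zero    = [] ∷ []
completions s (suc n) = concatMap (extend n) (moves s)
extend n (v , s) = map (v ∷_) (completions s n)

∈-completions⁺ : ∀ {s w} → Accepts s w → w ∈ completions s (length w)
∈-completions⁺ []       = here refl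
∈-completions⁺ {w = v ∷ w} (m ∷ ms) =
  ∈-concatMap⁺ (extend (length w)) (lose (∈-moves⁺ m) (∈-map⁺ (v ∷_) (∈-completions⁺ ms)))

∈-completions⁻ : ∀ {s w} n → w ∈ completions s n → length w ≡ n × Accepts s w
∈-completions⁻ zero (here refl) = refl , []
∈-completions⁻ {s} (suc n) w∈
  with (v , s′) , m∈ , w∈′ ← find (∈-concatMap⁻ (extend n) {xs = moves s} w∈)
  with w′ , w′∈ , refl ← ∈-map⁻ (v ∷_) w∈′
  with len , acc ← ∈-completions⁻ n w′∈ = cong suc len , ∈-moves⁻ s m∈ ∷ acc

DistinctLabels : List (ℕ × State) → Set
DistinctLabels = AllPairs (λ m m′ → proj₁ m ≢ proj₁ m′)

ups-above : ∀ {p} t d → p ≤ t → All (λ m → p < proj₁ m) (ups t d)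
ups-above t zero    p≤t = []
ups-above t (suc d) p≤t = s≤s p≤t ∷ ups-above (suc t) d (ℕₚ.m≤n⇒m≤1+n p≤t)

ups-distinct : ∀ t d → DistinctLabels (ups t d)
ups-distinct t zero    = []
ups-distinct t (suc d) = All.map ℕₚ.<⇒≢ (ups-above (suc t) d ℕₚ.≤-refl) ∷ ups-distinct (suc t) d

-- The automaton is deterministic, so distinct moves lead to words with distinct first letters and
-- no word is counted twice.
moves-distinct : ∀ s → DistinctLabels (moves s)
moves-distinct (done q d)  = All.map ℕₚ.<⇒≢ (ups-above q d z≤n) ∷ ups-distinct q d
moves-distinct (open₀ q d) = ((λ ()) ∷ All.map ℕₚ.<⇒≢ (ups-above (suc q) d z≤n)) ∷
  All.map ℕₚ.<⇒≢ (ups-above (suc q) d ℕₚ.≤-refl) ∷ ups-distinct (suc q) d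
moves-distinct (open₁ q d) = ((λ ()) ∷ All.map ℕₚ.<⇒≢ (ups-above (suc q) d z≤n)) ∷
  All.map ℕₚ.<⇒≢ (ups-above (suc q) d ℕₚ.≤-refl) ∷ ups-distinct (suc q) d

completions-unique : ∀ s n → Unique (completions s n)
completions-unique s zero    = [] ∷ []
completions-unique s (suc n) = Uniqueₚ.concat⁺
  (Allₚ.map⁺ (All.universal (λ (v , s′) → Uniqueₚ.map⁺ ∷-injectiveʳ (completions-unique s′ n)) (moves s)))
  (AllPairsₚ.map⁺ (AllPairs.map disjoint (moves-distinct s)))
  where
  disjoint : ∀ {m m′} → proj₁ m ≢ proj₁ m′ → ∀ {w} → ¬ (w ∈ extend n m × w ∈ extend n m′)
  disjoint ≢ (p , p′) with _ , _ , refl ← ∈-map⁻ _ p with _ , _ , eq ← ∈-map⁻ _ p′ = ≢ (∷-injectiveˡ eq)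

-- The number of completions does not depend on q.
#done #open₀ #open₁ #ups : ℕ → ℕ → ℕ
#done  d zero    = 1
#done  d (suc n) = #done d n ℕ.+ #ups d n
#open₀ d zero    = 1
#open₀ d (suc n) = #open₀ d n ℕ.+ (#done (suc d) n ℕ.+ #ups d n)
#open₁ d zero    = 1
#open₁ d (suc n) = #open₀ d n ℕ.+ (#done d n ℕ.+ #ups d n)
#ups zero    n = 0
#ups (suc d) n = #open₁ (suc d) n ℕ.+ #ups d n

length-concatMap-extend : ∀ n v s ms →
  length (concatMap (extend n) ((v , s) ∷ ms)) ≡ length (completions s n) ℕ.+ length (concatMap (extend n) ms)
length-concatMap-extend n v s ms = trans (length-++ (extend n (v , s)))
  (cong (ℕ._+ length (concatMap (extend n) ms)) (length-map (v ∷_) (completions s n)))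

length-done  : ∀ n q d → length (completions (done q d) n) ≡ #done d n
length-open₀ : ∀ n q d → length (completions (open₀ q d) n) ≡ #open₀ d n
length-open₁ : ∀ n q d → length (completions (open₁ q d) n) ≡ #open₁ d n
length-ups   : ∀ n q d → length (concatMap (extend n) (ups q d)) ≡ #ups d n
length-done  zero    q d = refl
length-done  (suc n) q d = trans (length-concatMap-extend n 0 _ (ups q d))
  (cong₂ ℕ._+_ (length-done n q d) (length-ups n q d))
length-open₀ zero    q d = refl
length-open₀ (suc n) q d = trans (length-concatMap-extend n 0 _ (again (open₀ q d) ++ ups (suc q) d))
  (cong₂ ℕ._+_ (length-open₀ n q d) (trans (length-concatMap-extend n _ _ (ups (suc q) d))
    (cong₂ ℕ._+_ (length-done n (suc q) (suc d)) (length-ups n (suc q) d))))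
length-open₁ zero    q d = refl
length-open₁ (suc n) q d = trans (length-concatMap-extend n 0 _ (again (open₁ q d) ++ ups (suc q) d))
  (cong₂ ℕ._+_ (length-open₀ n q d) (trans (length-concatMap-extend n _ _ (ups (suc q) d))
    (cong₂ ℕ._+_ (length-done n (suc q) d) (length-ups n (suc q) d))))
length-ups n q zero    = refl
length-ups n q (suc d) = trans (length-concatMap-extend n _ _ (ups (suc q) d))
  (cong₂ ℕ._+_ (length-open₁ n q (suc d)) (length-ups n (suc q) d))

-- Two duplicate-free lists with the same members are permutations of each other, hence equally
-- long.
b-suc : ∀ n → b (suc n) (0 ∷ 1 ∷ 1 ∷ 1 ∷ []) ≡ #done 1 n
b-suc n = begin
  length (enumerateB (suc n) τ)                 ≡⟨ ↭-length (∼bag⇒↭ (unique∧set⇒bag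
                                                     (enumerateB-unique (suc n) τ)
                                                     (Uniqueₚ.map⁺ ∷-injectiveʳ (completions-unique start n))
                                                     (mk⇔ to from))) ⟩
  length (map (0 ∷_) (completions start n))     ≡⟨ length-map (0 ∷_) (completions start n) ⟩
  length (completions start n)                  ≡⟨ length-done n 0 1 ⟩
  #done 1 n                                     ∎
  where
  open ≡-Reasoning
  τ : List ℕ
  τ = 0 ∷ 1 ∷ 1 ∷ 1 ∷ []
  B⇒∈ : ∀ {w} → B (suc n) τ w → w ∈ map (0 ∷_) (completions start n)
  B⇒∈ {y ∷ w} Bw@(_ , A , _) with refl ← proj₁ (A zero) refl
    with refl , acc ← Equivalence.to (B-0∷⇔accepts n w) Bw = ∈-map⁺ (0 ∷_) (∈-completions⁺ acc)
  ∈⇒B : ∀ {w} → w ∈ map (0 ∷_) (completions start n) → B (suc n) τ w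
  ∈⇒B w∈ with w′ , w′∈ , refl ← ∈-map⁻ (0 ∷_) w∈ =
    Equivalence.from (B-0∷⇔accepts n w′) (∈-completions⁻ n w′∈)
  to : ∀ {w} → w ∈ enumerateB (suc n) τ → w ∈ map (0 ∷_) (completions start n)
  to w∈ = B⇒∈ (∈-enumerateB⁻ {suc n} {τ} w∈)
  from : ∀ {w} → w ∈ map (0 ∷_) (completions start n) → w ∈ enumerateB (suc n) τ
  from w∈ = ∈-enumerateB⁺ {suc n} {τ} (∈⇒B w∈)

-- The ring of formal power series

module ℚ-Solver = +-*-Solver

-- By definition `(s * t) (suc n)` unfolds to `s 0 ℚ.* t (suc n) ℚ.+ (tail s * t) n`. Most product
-- laws below follow by induction on the coefficient, with `tail s` in place of `s`.
tail : PowerSeries → PowerSeries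
tail s = s ∘ suc

-- Unlike `const`, this embeds all of ℚ as a ring, which lets the ring solver use rational
-- coefficients.
scalar : ℚ → PowerSeries
scalar q zero    = q
scalar q (suc _) = 0ℚ

neg : PowerSeries → PowerSeries
neg s n = ℚ.- s n

*-cong : ∀ {s s′ t t′} → s ≈ s′ → t ≈ t′ → s * t ≈ s′ * t′
*-cong p q zero    = cong (ℚ._+ 0ℚ) (cong₂ ℚ._*_ (p 0) (q 0))
*-cong p q (suc n) = cong₂ ℚ._+_ (cong₂ ℚ._*_ (p 0) (q (suc n))) (*-cong (p ∘ suc) q n)

-- The definition of the product peels off the left factor only; commutativity also needs the right
-- factor peeled off.
*-sucʳ : ∀ s t n → (s * t) (suc n) ≡ s (suc n) ℚ.* t 0 ℚ.+ (s * tail t) n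
*-sucʳ s t zero    =
  solve 4 (λ s₀ s₁ t₀ t₁ → s₀ :* t₁ :+ (s₁ :* t₀ :+ con 0ℚ) := s₁ :* t₀ :+ (s₀ :* t₁ :+ con 0ℚ))
    refl (s 0) (s 1) (t 0) (t 1)
  where open ℚ-Solver
*-sucʳ s t (suc n) = trans (cong (s 0 ℚ.* t (2 ℕ.+ n) ℚ.+_) (*-sucʳ (tail s) t n))
  (solve 3 (λ p q r → p :+ (q :+ r) := q :+ (p :+ r)) refl
    (s 0 ℚ.* t (2 ℕ.+ n)) (s (2 ℕ.+ n) ℚ.* t 0) ((tail s * tail t) n))
  where open ℚ-Solver

*-comm : ∀ s t → s * t ≈ t * s
*-comm s t zero    = cong (ℚ._+ 0ℚ) (ℚₚ.*-comm (s 0) (t 0))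
*-comm s t (suc n) =
  trans (cong₂ ℚ._+_ (ℚₚ.*-comm (s 0) (t (suc n))) (*-comm (tail s) t n)) (sym (*-sucʳ t s n))

*-distribʳ-+ : ∀ u s t → (s + t) * u ≈ s * u + t * u
*-distribʳ-+ u s t zero    =
  solve 3 (λ s₀ t₀ u₀ → (s₀ :+ t₀) :* u₀ :+ con 0ℚ := (s₀ :* u₀ :+ con 0ℚ) :+ (t₀ :* u₀ :+ con 0ℚ))
    refl (s 0) (t 0) (u 0)
  where open ℚ-Solver
*-distribʳ-+ u s t (suc n) = trans (cong ((s 0 ℚ.+ t 0) ℚ.* u (suc n) ℚ.+_) (*-distribʳ-+ u (tail s) (tail t) n))
  (solve 5 (λ s₀ t₀ uₙ p q → (s₀ :+ t₀) :* uₙ :+ (p :+ q) := (s₀ :* uₙ :+ p) :+ (t₀ :* uₙ :+ q)) refl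
    (s 0) (t 0) (u (suc n)) ((tail s * u) n) ((tail t * u) n))
  where open ℚ-Solver

*-scale : ∀ q s t n → ((λ m → q ℚ.* s m) * t) n ≡ q ℚ.* (s * t) n
*-scale q s t zero    =
  solve 3 (λ q s₀ t₀ → (q :* s₀) :* t₀ :+ con 0ℚ := q :* (s₀ :* t₀ :+ con 0ℚ)) refl q (s 0) (t 0)
  where open ℚ-Solver
*-scale q s t (suc n) = trans (cong (q ℚ.* s 0 ℚ.* t (suc n) ℚ.+_) (*-scale q (tail s) t n))
  (solve 4 (λ q s₀ tₙ p → (q :* s₀) :* tₙ :+ q :* p := q :* (s₀ :* tₙ :+ p)) refl
    q (s 0) (t (suc n)) ((tail s * t) n))
  where open ℚ-Solver

*-assoc : ∀ s t u → (s * t) * u ≈ s * (t * u)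
*-assoc s t u zero    =
  solve 3 (λ s₀ t₀ u₀ → (s₀ :* t₀ :+ con 0ℚ) :* u₀ :+ con 0ℚ := s₀ :* (t₀ :* u₀ :+ con 0ℚ) :+ con 0ℚ) refl
    (s 0) (t 0) (u 0)
  where open ℚ-Solver
*-assoc s t u (suc n) = begin
  -- The tail of a product `s * t` is by definition `s 0` times `tail t`, plus `tail s * t`.
  s₀t₀ ℚ.* u (suc n) ℚ.+ (((λ m → s 0 ℚ.* tail t m) + tail s * t) * u) n
    ≡⟨ cong (s₀t₀ ℚ.* u (suc n) ℚ.+_) (*-distribʳ-+ u (λ m → s 0 ℚ.* tail t m) (tail s * t) n) ⟩
  s₀t₀ ℚ.* u (suc n) ℚ.+ (((λ m → s 0 ℚ.* tail t m) * u) n ℚ.+ ((tail s * t) * u) n)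
    ≡⟨ cong (s₀t₀ ℚ.* u (suc n) ℚ.+_)
         (cong₂ ℚ._+_ (*-scale (s 0) (tail t) u n) (*-assoc (tail s) t u n)) ⟩
  s₀t₀ ℚ.* u (suc n) ℚ.+ (s 0 ℚ.* (tail t * u) n ℚ.+ (tail s * (t * u)) n)
    ≡⟨ solve 5 (λ s₀ t₀ uₙ p q → (s₀ :* t₀ :+ con 0ℚ) :* uₙ :+ (s₀ :* p :+ q) := s₀ :* (t₀ :* uₙ :+ p) :+ q) refl
         (s 0) (t 0) (u (suc n)) ((tail t * u) n) ((tail s * (t * u)) n) ⟩
  s 0 ℚ.* (t 0 ℚ.* u (suc n) ℚ.+ (tail t * u) n) ℚ.+ (tail s * (t * u)) n ∎
  where
  open ≡-Reasoning
  open ℚ-Solver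
  s₀t₀ = (s * t) 0

zero-* : ∀ s t → (∀ n → s n ≡ 0ℚ) → ∀ n → (s * t) n ≡ 0ℚ
zero-* s t s≡0 zero    rewrite s≡0 0 = cong (ℚ._+ 0ℚ) (ℚₚ.*-zeroˡ (t 0))
zero-* s t s≡0 (suc n) rewrite s≡0 0 = cong₂ ℚ._+_ (ℚₚ.*-zeroˡ (t (suc n))) (zero-* (tail s) t (s≡0 ∘ suc) n)

scalar-* : ∀ q s n → (scalar q * s) n ≡ q ℚ.* s n
scalar-* q s zero    = ℚₚ.+-identityʳ (q ℚ.* s 0)
scalar-* q s (suc n) =
  trans (cong (q ℚ.* s (suc n) ℚ.+_) (zero-* _ s (λ _ → refl) n)) (ℚₚ.+-identityʳ _)

const≈scalar : ∀ c → const c ≈ scalar (+ c / 1)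
const≈scalar c zero    = refl
const≈scalar c (suc n) = refl

powerSeriesRing : CommutativeRing 0ℓ 0ℓ
powerSeriesRing = record
  { Carrier = PowerSeries ; _≈_ = _≈_ ; _+_ = _+_ ; _*_ = _*_ ; -_ = neg
  ; 0# = scalar 0ℚ ; 1# = scalar 1ℚ
  ; isCommutativeRing = record
    { isRing = record
      { +-isAbelianGroup = record
        { isGroup = record
          { isMonoid = record
            { isSemigroup = record
              { isMagma = record
                { isEquivalence = record
                  { refl = λ _ → refl ; sym = λ p n → sym (p n) ; trans = λ p q n → trans (p n) (q n) }
                ; ∙-cong = λ p q n → cong₂ ℚ._+_ (p n) (q n) }
              ; assoc = λ s t u n → ℚₚ.+-assoc (s n) (t n) (u n) }
            ; identity = (λ s → λ { zero → ℚₚ.+-identityˡ _ ; (suc n) → ℚₚ.+-identityˡ _ })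
                       , (λ s → λ { zero → ℚₚ.+-identityʳ _ ; (suc n) → ℚₚ.+-identityʳ _ }) }
          ; inverse = (λ s → λ { zero → ℚₚ.+-inverseˡ (s 0) ; (suc n) → ℚₚ.+-inverseˡ (s (suc n)) })
                    , (λ s → λ { zero → ℚₚ.+-inverseʳ (s 0) ; (suc n) → ℚₚ.+-inverseʳ (s (suc n)) })
          ; ⁻¹-cong = λ p n → cong ℚ.-_ (p n) }
        ; comm = λ s t n → ℚₚ.+-comm (s n) (t n) }
      ; *-cong = *-cong
      ; *-assoc = *-assoc
      ; *-identity = *-identityˡ , (λ s n → trans (*-comm s (scalar 1ℚ) n) (*-identityˡ s n))
      ; distrib = (λ s t u n → trans (*-comm s (t + u) n)
                     (trans (*-distribʳ-+ s t u n) (cong₂ ℚ._+_ (*-comm t s n) (*-comm u s n))))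
                , *-distribʳ-+ }
    ; *-comm = *-comm } }
  where
  *-identityˡ : ∀ s → scalar 1ℚ * s ≈ s
  *-identityˡ s n = trans (scalar-* 1ℚ s n) (ℚₚ.*-identityˡ (s n))

almostRing : AlmostCommutativeRing 0ℓ 0ℓ
almostRing = fromCommutativeRing powerSeriesRing

scalar-homomorphism :
  AlmostCommutativeRing.rawRing (fromCommutativeRing ℚₚ.+-*-commutativeRing)
    -Raw-AlmostCommutative⟶ almostRing
scalar-homomorphism = record
  { ⟦_⟧ = scalar
  ; +-homo = λ p q → λ { zero → refl ; (suc n) → refl }
  ; *-homo = λ p q → λ { zero → sym (ℚₚ.+-identityʳ (p ℚ.* q))
                       ; (suc n) → sym (trans (scalar-* p (scalar q) (suc n)) (ℚₚ.*-zeroʳ p)) }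
  ; -‿homo = λ p → λ { zero → refl ; (suc n) → refl }
  ; 0-homo = λ _ → refl
  ; 1-homo = λ _ → refl }

scalar≟ : (p q : ℚ) → Maybe (scalar p ≈ scalar q)
scalar≟ p q with p ℚₚ.≟ q
... | yes refl = just λ _ → refl
... | no  _    = nothing

open Algebra.Solver.Ring _ almostRing scalar-homomorphism scalar≟
  using (solve; _:=_; _:+_; _:*_; _:-_; con)

module R = CommutativeRing powerSeriesRing

Null : PowerSeries → Set
Null s = s ≈ scalar 0ℚ

null-difference : ∀ {s t} → s ≈ t → Null (s - t)
null-difference {s} {t} s≈t = R.trans (R.+-congʳ {neg t} s≈t) (R.-‿inverseʳ t)

null-+ : ∀ {s t} → Null s → Null t → Null (s + t)
null-+ p q = R.trans (R.+-cong p q) (R.+-identityˡ _)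

null-* : ∀ s {t} → Null t → Null (s * t)
null-* s p = R.trans (R.*-congˡ {s} p) (R.zeroʳ s)

-- Consequences of equations sᵢ ≈ tᵢ are obtained by adding a combination
-- of the series sᵢ − tᵢ, so that only a ring identity is left to check.
≈-modulo-null : ∀ {s t u} → s ≈ t + u → Null u → s ≈ t
≈-modulo-null {t = t} p q = R.trans p (R.trans (R.+-congˡ {t} q) (R.+-identityʳ t))

x*-zero : ∀ t → (x * t) 0 ≡ 0ℚ
x*-zero t = cong (ℚ._+ 0ℚ) (ℚₚ.*-zeroˡ (t 0))

x*-suc : ∀ t n → (x * t) (suc n) ≡ t n
x*-suc t n = begin
  0ℚ ℚ.* t (suc n) ℚ.+ (tail x * t) n ≡⟨ cong₂ ℚ._+_ (ℚₚ.*-zeroˡ (t (suc n)))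
                                              (*-cong {t = t} {t′ = t} tail-x (λ _ → refl) n) ⟩
  0ℚ ℚ.+ (scalar 1ℚ * t) n            ≡⟨ ℚₚ.+-identityˡ _ ⟩
  (scalar 1ℚ * t) n                   ≡⟨ R.*-identityˡ t n ⟩
  t n                                 ∎
  where
  open ≡-Reasoning
  tail-x : tail x ≈ scalar 1ℚ
  tail-x zero    = refl
  tail-x (suc n) = refl

shift : ∀ {s t} → s 0 ≡ 1ℚ → (∀ n → s (suc n) ≡ t n) → s ≈ scalar 1ℚ + x * t
shift {t = t} s₀ sₙ zero    = trans s₀ (sym (cong (1ℚ ℚ.+_) (x*-zero t)))
shift {t = t} s₀ sₙ (suc n) = trans (sₙ n) (sym (trans (ℚₚ.+-identityˡ _) (x*-suc t n)))

NullBelow : ℕ → PowerSeries → Set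
NullBelow n s = ∀ i → i < n → s i ≡ 0ℚ

nullBelow-+ : ∀ {n s t} → NullBelow n s → NullBelow n t → NullBelow n (s + t)
nullBelow-+ p q i i<n = cong₂ ℚ._+_ (p i i<n) (q i i<n)

nullBelow-* : ∀ {n} s {t} → NullBelow n t → NullBelow n (s * t)
nullBelow-* s p zero    i<n = cong (ℚ._+ 0ℚ) (trans (cong (s 0 ℚ.*_) (p 0 i<n)) (ℚₚ.*-zeroʳ (s 0)))
nullBelow-* s p (suc i) i<n = cong₂ ℚ._+_
  (trans (cong (s 0 ℚ.*_) (p (suc i) i<n)) (ℚₚ.*-zeroʳ (s 0)))
  (nullBelow-* (tail s) p i (ℕₚ.<-trans (ℕₚ.n<1+n i) i<n))

-- Solving the system of functional equations

k₂ k₄ : ℚ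
k₂ = + 2 / 1
k₄ = + 4 / 1

module System
  (A B C S : ℕ → PowerSeries)
  (A-eq : ∀ d → A d ≈ scalar 1ℚ + x * (A d + S d))
  (B-eq : ∀ d → B d ≈ scalar 1ℚ + x * (B d + (A (suc d) + S d)))
  (C-eq : ∀ d → C d ≈ scalar 1ℚ + x * (B d + (A d + S d)))
  (S-zero : Null (S 0))
  (S-suc : ∀ d → S (suc d) ≈ C (suc d) + S d)
  where

  correction : (a₀ a₁ a₂ : PowerSeries) → PowerSeries
  correction a₀ a₁ a₂ = (scalar (+ 3 / 1) - x - x * x) * a₁ + ((x - scalar k₂) * a₀ + x * x * a₂)

  -- This is (1 − x)(1 − 2x − x²) A (1 + d) ≈ (1 − x)² A d + x³ A (2 + d), with all
  -- terms divisible by x collected in the correction.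
  recurrence : ∀ d → A (suc d) ≈ A d + x * correction (A d) (A (suc d)) (A (2 ℕ.+ d))
  recurrence d = ≈-modulo-null
    (solve 8 (λ x A₀ A₁ A₂ B₁ C₁ S₀ S₁ →
        let one = con 1ℚ
            δA₀ = A₀ :- (one :+ x :* (A₀ :+ S₀))
            δA₁ = A₁ :- (one :+ x :* (A₁ :+ S₁))
            δB₁ = B₁ :- (one :+ x :* (B₁ :+ (A₂ :+ S₁)))
            δC₁ = C₁ :- (one :+ x :* (B₁ :+ (A₁ :+ S₁)))
            δS₁ = S₁ :- (C₁ :+ S₀)
        in A₁ := A₀ :+ x :* ((con (+ 3 / 1) :- x :- x :* x) :* A₁ :+ ((x :- con k₂) :* A₀ :+ x :* x :* A₂))
             -- The multipliers come from linear elimination: in this combination the total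
             -- coefficients of `S₀`, `S₁`, `B₁` and `C₁` vanish.
             :+ ((x :- one) :* δA₀
               :+ ((one :- x :- x :* (one :- x) :- x :* x) :* δA₁
               :+ (x :* x :* δB₁ :+ (x :* (one :- x) :* δC₁ :+ (one :- x) :* x :* δS₁)))))
      (λ _ → refl) x (A d) (A (suc d)) (A (2 ℕ.+ d)) (B (suc d)) (C (suc d)) (S d) (S (suc d)))
    (null-+ (null-* (x - 1#) (null-difference (A-eq d)))
    (null-+ (null-* (1# - x - x * (1# - x) - x * x) (null-difference (A-eq (suc d))))
    (null-+ (null-* (x * x) (null-difference (B-eq (suc d))))
    (null-+ (null-* (x * (1# - x)) (null-difference (C-eq (suc d))))
            (null-* ((1# - x) * x) (null-difference (S-suc d)))))))
    where
    1# : PowerSeries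
    1# = scalar 1ℚ

  minor : ℕ → PowerSeries
  minor d = A (suc d) * A 0 - A d * A 1

  minor-zero : Null (minor 0)
  minor-zero = null-difference (*-comm (A 1) (A 0))

  -- The recurrence is linear with coefficients independent of `d`, so it passes to the combination
  -- of two consecutive terms with the fixed multipliers `A 0` and - `A 1`.
  minor-suc : ∀ d → minor (suc d) ≈ minor d + x * correction (minor d) (minor (suc d)) (minor (2 ℕ.+ d))
  minor-suc d = ≈-modulo-null
    (solve 7 (λ x a₀ a₁ A₀ A₁ A₂ A₃ →
        let cor = λ p q r → (con (+ 3 / 1) :- x :- x :* x) :* q :+ ((x :- con k₂) :* p :+ x :* x :* r)
            p = A₁ :* a₀ :- A₀ :* a₁
            q = A₂ :* a₀ :- A₁ :* a₁
            r = A₃ :* a₀ :- A₂ :* a₁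
        in q := p :+ x :* cor p q r
             :+ (a₀ :* (A₂ :- (A₁ :+ x :* cor A₁ A₂ A₃)) :+ (con 0ℚ :- a₁) :* (A₁ :- (A₀ :+ x :* cor A₀ A₁ A₂))))
      (λ _ → refl) x (A 0) (A 1) (A d) (A (suc d)) (A (2 ℕ.+ d)) (A (3 ℕ.+ d)))
    (null-+ (null-* (A 0) (null-difference (recurrence (suc d))))
            (null-* (scalar 0ℚ - A 1) (null-difference (recurrence d))))

  -- `minor-suc` determines coefficient n of minor (1 + d) by coefficient n of
  -- minor d and by coefficients below n.
  minor-nullBelow : ∀ n d → NullBelow n (minor d)
  minor-nullBelow (suc n) zero    i _  = trans (minor-zero i) (null i)
    where
    null : ∀ i → scalar 0ℚ i ≡ 0ℚ
    null zero    = refl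
    null (suc i) = refl
  minor-nullBelow (suc n) (suc d) i i< = trans (minor-suc d i)
    (cong₂ ℚ._+_ (minor-nullBelow (suc n) d i i<) (shifted i i<))
    where
    T = correction (minor d) (minor (suc d)) (minor (2 ℕ.+ d))
    T-null : NullBelow n T
    -- The index `2 + d` is larger than the one being treated, but the bound has dropped to `n`: the
    -- induction is lexicographic in (`n`, `d`).
    T-null = nullBelow-+ (nullBelow-* (scalar (+ 3 / 1) - x - x * x) (minor-nullBelow n (suc d)))
               (nullBelow-+ (nullBelow-* (x - scalar k₂) (minor-nullBelow n d))
                            (nullBelow-* (x * x) (minor-nullBelow n (2 ℕ.+ d))))
    shifted : NullBelow (suc n) (x * T)
    shifted zero    _  = x*-zero T
    shifted (suc i) i< = trans (x*-suc T i) (T-null i (ℕ.s≤s⁻¹ i<))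

  minor-null : ∀ d → Null (minor d)
  minor-null d zero    = minor-nullBelow 1 d 0 (ℕₚ.n<1+n 0)
  minor-null d (suc i) = minor-nullBelow (2 ℕ.+ i) d (suc i) (ℕₚ.n<1+n (suc i))

  A-zero : A 0 ≈ scalar 1ℚ + x * A 0
  A-zero = ≈-modulo-null
    (solve 3 (λ x a s → a := con 1ℚ :+ x :* a :+ ((a :- (con 1ℚ :+ x :* (a :+ s))) :+ x :* s))
      (λ _ → refl) x (A 0) (S 0))
    (null-+ (null-difference (A-eq 0)) (null-* x S-zero))

  -- The value (1 - x)² - 2x²F that the closed form predicts for the square root. By `sqrt-unique`
  -- it suffices to compute its square and its constant term.
  root : PowerSeries
  root = (scalar 1ℚ - x) * (scalar 1ℚ - x) - scalar k₂ * (x * x) * (scalar 1ℚ + x * A 1)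

  -- The difference of both sides is 4x² (x²F² − (1 − x)²F + 1 − x) with F = 1 + x A₁.
  root-square : root * root ≈ scalar 1ℚ - scalar k₄ * x + scalar k₂ * (x * x) + x * (x * (x * x))
  root-square = ≈-modulo-null
    (solve 4 (λ x a₀ a₁ a₂ →
        let one = con 1ℚ
            r = (one :- x) :* (one :- x) :- con k₂ :* (x :* x) :* (one :+ x :* a₁)
            cor = (con (+ 3 / 1) :- x :- x :* x) :* a₁ :+ ((x :- con k₂) :* a₀ :+ x :* x :* a₂)
            e = a₀ :- (one :+ x :* a₀)
            g = one :- con k₂ :* x :- x :* x
        in r :* r := one :- con k₄ :* x :+ con k₂ :* (x :* x) :+ x :* (x :* (x :* x))
             :+ (con (ℚ.- k₄) :* (x :* (x :* x)))
               -- Put (1 - x) a₀ = 1 + e. The first two summands add up to (1 + e) g a₁ - (1 + e)² -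
               -- x³a₁²; the third cancels everything divisible by e and leaves g a₁ - 1 - x³a₁².
               :* (a₀ :* (a₁ :- (a₀ :+ x :* cor)) :+ (x :* (x :* x) :* (a₂ :* a₀ :- a₁ :* a₁)
                 :+ ((con k₂ :+ e) :- g :* a₁) :* e)))
      (λ _ → refl) x (A 0) (A 1) (A 2))
    (null-* (scalar (ℚ.- k₄) * (x * (x * x)))
      (null-+ (null-* (A 0) (null-difference (recurrence 0)))
      (null-+ (null-* (x * (x * x)) (minor-null 1))
        (null-* (scalar k₂ + (A 0 - (scalar 1ℚ + x * A 0)) - (scalar 1ℚ - scalar k₂ * x - x * x) * A 1)
          (null-difference A-zero)))))

  radicand : PowerSeries
  radicand = const 1 - const 4 * x + const 2 * x ^ 2 + x ^ 4

  radicand≈ : radicand ≈ scalar 1ℚ - scalar k₄ * x + scalar k₂ * (x * x) + x * (x * (x * x))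
  radicand≈ = R.+-cong (R.+-cong (R.+-cong (const≈scalar 1)
                                           (R.-‿cong {const 4 * x} (R.*-congʳ {x} (const≈scalar 4))))
     (R.*-cong (const≈scalar 2) x²)) (R.*-congˡ {x} (R.*-congˡ {x} x²))
    where
    x² : x ^ 2 ≈ x * x
    x² = R.*-congˡ {x} (R.trans (R.*-congˡ {x} (const≈scalar 1)) (R.*-identityʳ x))

  root₀ : root 0 ≡ 1ℚ
  root₀ = cong (λ q → 1ℚ ℚ.- (q ℚ.+ 0ℚ)) (ℚₚ.*-zeroˡ ((scalar 1ℚ + x * A 1) 0))

  root≈sqrt : root ≈ sqrt radicand
  root≈sqrt = sqrt-unique radicand refl root root₀ (R.trans root-square (R.sym radicand≈))

  closed-form : ∀ {g} → g ≈ scalar 1ℚ + x * A 1 → const 2 * x ^ 2 * g ≈ (const 1 - x) ^ 2 - sqrt radicand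
  closed-form {g} g≈ = R.trans (R.*-cong (R.*-cong (const≈scalar 2) x²) g≈)
    (R.trans (solve 2 (λ x h → con k₂ :* (x :* (x :* con 1ℚ)) :* h := (con 1ℚ :- x) :* ((con 1ℚ :- x) :* con 1ℚ)
         :- ((con 1ℚ :- x) :* (con 1ℚ :- x) :- con k₂ :* (x :* x) :* h)) (λ _ → refl) x (scalar 1ℚ + x * A 1))
      (R.+-cong (R.*-cong 1-x (R.*-cong 1-x (R.sym (const≈scalar 1)))) (R.-‿cong root≈sqrt)))
    where
    x² : x ^ 2 ≈ x * (x * scalar 1ℚ)
    x² = R.*-congˡ {x} (R.*-congˡ {x} (const≈scalar 1))
    1-x : scalar 1ℚ - x ≈ const 1 - x
    1-x = R.+-congʳ {neg x} (R.sym (const≈scalar 1))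

-- Natural numbers as rationals

fromℕ : ℕ → ℚ
fromℕ n = + n / 1

-- `+ n / 1` is normalised by a gcd and does not compute for variable `n`, so the sum is compared
-- among unnormalised rationals.
fromℕ-+ : ∀ m n → fromℕ (m ℕ.+ n) ≡ fromℕ m ℚ.+ fromℕ n
fromℕ-+ m n = ℚₚ.toℚᵘ-injective (begin
  ℚ.toℚᵘ (fromℕ (m ℕ.+ n))                 ≈⟨ ℚₚ.toℚᵘ-fromℚᵘ (ℚᵘ.mkℚᵘ (+ (m ℕ.+ n)) 0) ⟩
  ℚᵘ.mkℚᵘ (+ (m ℕ.+ n)) 0                  ≈⟨ ℚᵘ.*≡* (cong (ℤ._* + 1)
                                                (sym (cong₂ ℤ._+_ (ℤₚ.*-identityʳ (+ m)) (ℤₚ.*-identityʳ (+ n))))) ⟩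
  ℚᵘ.mkℚᵘ (+ m) 0 ℚᵘ.+ ℚᵘ.mkℚᵘ (+ n) 0     ≈⟨ ℚᵘₚ.+-cong (ℚₚ.toℚᵘ-fromℚᵘ (ℚᵘ.mkℚᵘ (+ m) 0))
                                                   (ℚₚ.toℚᵘ-fromℚᵘ (ℚᵘ.mkℚᵘ (+ n) 0)) ⟨
  ℚ.toℚᵘ (fromℕ m) ℚᵘ.+ ℚ.toℚᵘ (fromℕ n)   ≈⟨ ℚₚ.toℚᵘ-homo-+ (fromℕ m) (fromℕ n) ⟨
  ℚ.toℚᵘ (fromℕ m ℚ.+ fromℕ n)             ∎)
  where open ℚᵘₚ.≃-Reasoning

-- The generating functions of the automaton

countSeries : (ℕ → ℕ → ℕ) → ℕ → PowerSeries
countSeries c d n = fromℕ (c d n)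

fromℕ-+₃ : ∀ k m n → fromℕ (k ℕ.+ (m ℕ.+ n)) ≡ fromℕ k ℚ.+ (fromℕ m ℚ.+ fromℕ n)
fromℕ-+₃ k m n = trans (fromℕ-+ k (m ℕ.+ n)) (cong (fromℕ k ℚ.+_) (fromℕ-+ m n))

DONE OPEN₀ OPEN₁ UPS : ℕ → PowerSeries
DONE  = countSeries #done
OPEN₀ = countSeries #open₀
OPEN₁ = countSeries #open₁
UPS   = countSeries #ups

DONE-eq : ∀ d → DONE d ≈ scalar 1ℚ + x * (DONE d + UPS d)
DONE-eq d = shift refl λ n → fromℕ-+ (#done d n) (#ups d n)

OPEN₀-eq : ∀ d → OPEN₀ d ≈ scalar 1ℚ + x * (OPEN₀ d + (DONE (suc d) + UPS d))
OPEN₀-eq d = shift refl λ n → fromℕ-+₃ (#open₀ d n) (#done (suc d) n) (#ups d n)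

OPEN₁-eq : ∀ d → OPEN₁ d ≈ scalar 1ℚ + x * (OPEN₀ d + (DONE d + UPS d))
OPEN₁-eq d = shift refl λ n → fromℕ-+₃ (#open₀ d n) (#done d n) (#ups d n)

UPS-zero : Null (UPS 0)
UPS-zero zero    = refl
UPS-zero (suc n) = refl

UPS-suc : ∀ d → UPS (suc d) ≈ OPEN₁ (suc d) + UPS d
UPS-suc d n = fromℕ-+ (#open₁ (suc d) n) (#ups d n)

module Automaton = System DONE OPEN₀ OPEN₁ UPS DONE-eq OPEN₀-eq OPEN₁-eq UPS-zero UPS-suc

theorem3p5 : const 2 * x ^ 2 * f (0 ∷ 1 ∷ 1 ∷ 1 ∷ [])
    ≈ (const 1 - x) ^ 2 - sqrt (const 1 - const 4 * x + const 2 * x ^ 2 + x ^ 4)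
theorem3p5 = Automaton.closed-form {f (0 ∷ 1 ∷ 1 ∷ 1 ∷ [])}
  -- `b 0` evaluates to 1 for the empty sequence; the leading 0 of any other sequence contributes
  -- the factor `x`, and `start` has slack 1.
  (shift {f (0 ∷ 1 ∷ 1 ∷ 1 ∷ [])} {DONE 1} refl λ n → cong fromℕ (b-suc n))
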